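{- Let $\sigma$ be a finite relational signature and let $\mathfrak{A},\mathfrak{B}$ be compatible sets of $k$-pebbled $\sigma$-structures which disagree on a sentence of $\mathcal{L}^k$ with $r$ quantifiers. Then there exists some $\phi\in\mathcal{L}^k$ which $\mathfrak{A}$ and $\mathfrak{B}$ disagree on with $|\phi|=2^{O(k^k)}\cdot r$.
   Context: All structures are finite and relational. $\mathcal{L}^k$ is the set of first-order formulas (with equality) using only the variables $x_1,\dots,x_k$. $|\phi|$ is the total number of symbols in $\phi$; the number of quantifiers is the number of quantifier occurrences. A $k$-pebbled structure $\mathcal{X}^\alpha$ is a structure $\mathcal{X}$ with a partial assignment $\alpha$ of the variables $x_1,\dots,x_k$ to elements of $\mathcal{X}$; $\mathcal{X}^\alpha\models\phi$ means $(\mathcal{X},\alpha)\models\phi$. Sets of pebbled structures are compatible if all their members have the same signature and the same $\mathrm{dom}(\alpha)$. $\mathfrak{A}$ and $\mathfrak{B}$ disagree on $\phi$ if every member of $\mathfrak{A}$ satisfies $\phi$ and no member of $\mathfrak{B}$ does. The constant hidden in $O(k^k)$ may depend on $\sigma$. -}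

module Defs where

open import Data.Fin.Base using (Fin)
open import Data.Maybe using (Maybe; just; Is-just)
open import Data.Nat.Base using (ℕ; suc; _+_; _∸_; NonZero)
open import Data.Product using (∃-syntax; _×_)
open import Data.Sum using (_⊎_)
open import Data.Vec.Base using (Vec)
open import Data.Vec.Functional using (Vector; updateAt)
open import Data.Vec.Membership.Propositional using () renaming (_∈_ to _∈ᵥ_)
open import Data.Vec.Relation.Binary.Pointwise.Inductive using (Pointwise)
open import Function.Base using (const)
open import Function.Bundles using (_↔_)
open import Level using (Level; 0ℓ) renaming (suc to lsuc; _⊔_ to _⊔ˡ_)
open import Relation.Binary.PropositionalEquality using (_≡_; _≢_)
open import Relation.Nullary.Negation using (¬_)
open import Relation.Unary using (Pred; Decidable; Empty; _∈_; _∪_; _⊆_; _≐_)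

private
  variable
    a b : Level
    k : ℕ

-- Arities are positive, as usual for relation symbols. A nullary symbol would
-- be a sentence without quantifiers, for which a size bound of the form
-- "constant times number of quantifiers" is impossible.
record Signature : Set where
  field
    #symbols : ℕ
    arity    : Fin #symbols → ℕ
    positive : ∀ R → NonZero (arity R)

open Signature public

-- The universe may be empty. Decidability of the relations is automatic
-- classically; constructively it is part of a structure being finite.
record Structure (σ : Signature) : Set₁ where
  field
    Carrier : Set
    finite  : ∃[ n ] (Carrier ↔ Fin n)
    ⟦_⟧     : (R : Fin (#symbols σ)) → Pred (Vec Carrier (arity σ R)) 0ℓ
    ⟦_⟧?    : (R : Fin (#symbols σ)) → Decidable (⟦_⟧ R)

infix  8 _≈′_
infix  7 ¬′_
infixr 6 _∧′_
infixr 5 _∨′_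
infix  4 ∃′_∙_ ∀′_∙_

data Formula (σ : Signature) (k : ℕ) : Set where
  rel        : (R : Fin (#symbols σ)) → Vec (Fin k) (arity σ R) → Formula σ k
  _≈′_       : (x y : Fin k) → Formula σ k
  ¬′_        : Formula σ k → Formula σ k
  _∧′_ _∨′_  : (φ ψ : Formula σ k) → Formula σ k
  ∃′_∙_ ∀′_∙_ : (x : Fin k) → Formula σ k → Formula σ k

module _ {σ : Signature} where

  Free : Formula σ k → Pred (Fin k) 0ℓ
  Free (rel R xs) x = x ∈ᵥ xs
  Free (y ≈′ z)   x = x ≡ y ⊎ x ≡ z
  Free (¬′ φ)     x = Free φ x
  Free (φ ∧′ ψ)   x = Free φ x ⊎ Free ψ x
  Free (φ ∨′ ψ)   x = Free φ x ⊎ Free ψ x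
  Free (∃′ y ∙ φ) x = x ≢ y × Free φ x
  Free (∀′ y ∙ φ) x = x ≢ y × Free φ x

  Sentence : Formula σ k → Set
  Sentence φ = Empty (Free φ)

  #quantifiers : Formula σ k → ℕ
  #quantifiers (rel R xs) = 0
  #quantifiers (x ≈′ y)   = 0
  #quantifiers (¬′ φ)     = #quantifiers φ
  #quantifiers (φ ∧′ ψ)   = #quantifiers φ + #quantifiers ψ
  #quantifiers (φ ∨′ ψ)   = #quantifiers φ + #quantifiers ψ
  #quantifiers (∃′ x ∙ φ) = suc (#quantifiers φ)
  #quantifiers (∀′ x ∙ φ) = suc (#quantifiers φ)

  -- The length of the string written with R(x,…,y), x=y, ¬φ, (φ∧ψ), (φ∨ψ),
  -- ∃xφ and ∀xφ, each variable and relation symbol being a single symbol.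
  size : Formula σ k → ℕ
  size (rel R xs) = 3 + arity σ R + (arity σ R ∸ 1)
  size (x ≈′ y)   = 3
  size (¬′ φ)     = 1 + size φ
  size (φ ∧′ ψ)   = 3 + size φ + size ψ
  size (φ ∨′ ψ)   = 3 + size φ + size ψ
  size (∃′ x ∙ φ) = 2 + size φ
  size (∀′ x ∙ φ) = 2 + size φ

  module _ (𝒳 : Structure σ) where
    open Structure 𝒳

    Assignment : ℕ → Set
    Assignment k = Vector (Maybe Carrier) k

    -- Meaningful only if α is defined on all free variables of the formula,
    -- in which case it is Tarski's definition.
    Sat : Assignment k → Formula σ k → Set
    Sat α (rel R xs) =
      ∃[ us ] (Pointwise (λ x u → α x ≡ just u) xs us × ⟦ R ⟧ us)
    Sat α (x ≈′ y)   = ∃[ u ] (α x ≡ just u × α y ≡ just u)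
    Sat α (¬′ φ)     = ¬ Sat α φ
    Sat α (φ ∧′ ψ)   = Sat α φ × Sat α ψ
    Sat α (φ ∨′ ψ)   = Sat α φ ⊎ Sat α ψ
    Sat α (∃′ x ∙ φ) = ∃[ u ] Sat (updateAt α x (const (just u))) φ
    Sat α (∀′ x ∙ φ) = ∀ u → Sat (updateAt α x (const (just u))) φ

record PebbledStructure (σ : Signature) (k : ℕ) : Set₁ where
  field
    structure  : Structure σ
    assignment : Assignment structure k

module _ {σ : Signature} where
  open PebbledStructure

  dom : PebbledStructure σ k → Pred (Fin k) 0ℓ
  dom X x = Is-just (assignment X x)

  infix 4 _⊨_

  _⊨_ : PebbledStructure σ k → Formula σ k → Set
  X ⊨ φ = Sat (structure X) (assignment X) φ

  -- That the signatures agree is enforced by the type.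
  Compatible : Pred (PebbledStructure σ k) a → Pred (PebbledStructure σ k) b →
               Set (lsuc 0ℓ ⊔ˡ a ⊔ˡ b)
  Compatible 𝔄 𝔅 = ∀ X Y → X ∈ 𝔄 ∪ 𝔅 → Y ∈ 𝔄 ∪ 𝔅 → dom X ≐ dom Y

  -- The first component says that φ has a truth value in every member.
  DisagreeOn : Formula σ k →
               Pred (PebbledStructure σ k) a → Pred (PebbledStructure σ k) b →
               Set (lsuc 0ℓ ⊔ˡ a ⊔ˡ b)
  DisagreeOn φ 𝔄 𝔅 =
    (∀ X → X ∈ 𝔄 ∪ 𝔅 → Free φ ⊆ dom X) ×
    (∀ X → X ∈ 𝔄 → X ⊨ φ) ×
    (∀ X → X ∈ 𝔅 → ¬ X ⊨ φ)

{-# OPTIONS --safe #-}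
-- Satisfaction in a finite structure is decidable, so formulas have Boolean
-- truth values. A formula is compressed bottom-up: either it is a Boolean
-- combination of atoms, or it is equivalent to (±χ ∧ θ₁) ∨ θ₂ for a single
-- subformula χ and Boolean combinations of atoms θ₁ and θ₂. Since this shape is
-- closed under negation and under conjunction with a Boolean combination of
-- atoms, a new χ is needed only at a quantifier or when two formulas with
-- quantifiers are joined, which together happens fewer than 2r times. By Shannon
-- expansion, a Boolean combination of N atoms has size O(2^N), and there are
-- only O(k^k) atoms.
module Submission where

open import Defs
open import Data.Bool.Base using (Bool; true; false; not; _∧_; _∨_; _xor_; if_then_else_)
open import Data.Bool.Properties using (∨-identityʳ; ∧-identityʳ; ∧-comm; ∧-assoc; ∧-distribʳ-∨;
  not-involutive; not-distribˡ-xor; ∨-∧-booleanAlgebra)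
import Algebra.Lattice.Properties.BooleanAlgebra ∨-∧-booleanAlgebra as BooleanAlgebra
open import Data.Empty using (⊥-elim)
open import Data.Fin.Base using (Fin)
import Data.Fin.Properties as Fin
open import Data.List.Base as List using (List; []; _∷_; [_]; _++_; length; concatMap;
  cartesianProductWith; allFin; filter)
open import Data.List.Extrema.Nat using (max; xs≤max; ⊥≤max)
open import Data.List.Membership.Propositional using () renaming (_∈_ to _∈ˡ_)
open import Data.List.Membership.Propositional.Properties
  using (∈-++⁺ˡ; ∈-++⁺ʳ; ∈-map⁺; ∈-concatMap⁺; ∈-cartesianProductWith⁺; ∈-filter⁺; ∈-filter⁻;
  ∈-allFin)
open import Data.List.Properties using (length-map; length-++; length-filter; length-tabulate)
open import Data.List.Relation.Unary.All as All using (All; []; _∷_)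
import Data.List.Relation.Unary.All.Properties as All
import Data.List.Relation.Unary.Any as Any
open import Data.Maybe.Base using (just; nothing)
open import Data.Nat
  using (ℕ; suc; _+_; _*_; _^_; _∸_; _≤_; NonZero; >-nonZero; >-nonZero⁻¹; z≤n; s≤s)
open import Data.Nat.Properties
open import Data.Nat.Tactic.RingSolver using (solve-∀)
open import Data.Product using (∃; ∃-syntax; _×_; _,_; proj₂; map₂)
import Data.Product.Properties as Product
open import Data.Sum using (_⊎_; inj₁; inj₂; [_,_]′)
import Data.Sum as Sum
import Data.Sum.Properties as Sum
open import Data.Vec.Base using (Vec; []; _∷_)
open import Data.Vec.Functional using (updateAt)
open import Data.Vec.Functional.Properties using (updateAt-updates)
open import Data.Vec.Membership.Propositional using () renaming (_∈_ to _∈ᵥ_)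
import Data.Vec.Relation.Unary.Any as Vec
open import Data.Vec.Relation.Binary.Pointwise.Inductive using (Pointwise; []; _∷_)
import Data.Vec.Properties as Vec
open import Function.Base using (const; _∘_; id; case_of_)
open import Function.Bundles using (mk⇔; Inverse)
open import Function.Properties.Inverse using (↔⇒↣)
open import Level using (Level; 0ℓ)
open import Relation.Binary.Definitions using (DecidableEquality)
open import Relation.Binary.PropositionalEquality
  using (_≡_; refl; sym; trans; cong; cong₂; subst)
open import Relation.Nullary.Decidable
  using (Dec; yes; no; does; map′; ¬?; _×-dec_; _⊎-dec_; does-⇔; dec-true)
open import Relation.Nullary.Negation using (contradiction)
open import Relation.Unary using (Pred; _⊆_; Decidable)

private
  variable
    k n r : ℕ

-- Decidability of satisfaction and Boolean truth values.

does-transfer : ∀ {p q} {P : Set p} {Q : Set q} (p? : Dec P) (q? : Dec Q) →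
                does p? ≡ does q? → P → Q
does-transfer _        (yes q) _  _ = q
does-transfer (yes _)  (no _)  () _
does-transfer (no ¬p)  (no _)  _  p = contradiction p ¬p

module _ {σ : Signature} where

  module _ (𝒳 : Structure σ) where
    open Structure 𝒳
    private module Enumeration = Inverse (proj₂ finite)

    infix 4 _≟ᶜ_
    _≟ᶜ_ : DecidableEquality Carrier
    _≟ᶜ_ = Fin.inj⇒≟ (↔⇒↣ (proj₂ finite))

    ∃? : {P : Pred Carrier 0ℓ} → Decidable P → Dec (∃ P)
    ∃? {P} P? = map′ (λ (i , p) → Enumeration.from i , p)
      (λ (u , p) → Enumeration.to u , subst P (sym (Enumeration.strictlyInverseʳ u)) p)
      (Fin.any? (P? ∘ Enumeration.from))

    ∀? : {P : Pred Carrier 0ℓ} → Decidable P → Dec (∀ u → P u)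
    ∀? {P} P? = map′ (λ p u → subst P (Enumeration.strictlyInverseʳ u) (p (Enumeration.to u)))
      (λ p i → p (Enumeration.from i)) (Fin.all? (P? ∘ Enumeration.from))

    lookups? : (α : Assignment 𝒳 k) {P : Pred (Vec Carrier n) 0ℓ} → Decidable P →
               (xs : Vec (Fin k) n) →
               Dec (∃[ us ] (Pointwise (λ x u → α x ≡ just u) xs us × P us))
    lookups? α P? []       = map′ (λ p → [] , [] , p) (λ { ([] , [] , p) → p }) (P? [])
    lookups? α P? (x ∷ xs) with α x in αx
    ... | nothing = no λ { (_ , (eq ∷ _) , _) → case trans (sym αx) eq of λ () }
    ... | just u  = map′ (λ (us , eqs , p) → u ∷ us , αx ∷ eqs , p)
      (λ { (_ , (eq ∷ eqs) , p) → case trans (sym αx) eq of λ { refl → _ , eqs , p } })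
      (lookups? α (P? ∘ (u ∷_)) xs)

    Sat? : (α : Assignment 𝒳 k) (φ : Formula σ k) → Dec (Sat 𝒳 α φ)
    Sat? α (rel R xs) = lookups? α ⟦ R ⟧? xs
    -- Equality is treated as one more binary relation, so that undefined variables are handled by
    -- `lookups?` here too.
    Sat? α (x ≈′ y)   = map′
      (λ { (_ , (p ∷ q ∷ []) , refl) → _ , p , q })
      (λ { (u , p , q) → u ∷ u ∷ [] , p ∷ q ∷ [] , refl })
      (lookups? α {λ { (u ∷ v ∷ []) → u ≡ v }} (λ { (u ∷ v ∷ []) → u ≟ᶜ v }) (x ∷ y ∷ []))
    Sat? α (¬′ φ)     = ¬? (Sat? α φ)
    Sat? α (φ ∧′ ψ)   = Sat? α φ ×-dec Sat? α ψ
    Sat? α (φ ∨′ ψ)   = Sat? α φ ⊎-dec Sat? α ψ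
    Sat? α (∃′ x ∙ φ) = ∃? λ u → Sat? (updateAt α x (const (just u))) φ
    Sat? α (∀′ x ∙ φ) = ∀? λ u → Sat? (updateAt α x (const (just u))) φ

  -- With Boolean values, propositional equivalences of formulas become equations of Boolean
  -- algebra. All partial assignments are covered, including those undefined on free variables.
  Meaning : ℕ → Set₁
  Meaning k = (𝒳 : Structure σ) → Assignment 𝒳 k → Bool

  infix 4 _≐ᵗ_
  _≐ᵗ_ : Meaning k → Meaning k → Set₁
  t ≐ᵗ t′ = ∀ 𝒳 α → t 𝒳 α ≡ t′ 𝒳 α

  truth : Formula σ k → Meaning k
  truth φ 𝒳 α = does (Sat? 𝒳 α φ)

  truth⇒Sat : (φ ψ : Formula σ k) → truth φ ≐ᵗ truth ψ → ∀ 𝒳 α → Sat 𝒳 α φ → Sat 𝒳 α ψ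
  truth⇒Sat φ ψ eq 𝒳 α = does-transfer (Sat? 𝒳 α φ) (Sat? 𝒳 α ψ) (eq 𝒳 α)

  -- The body is evaluated at updated assignments, so the equivalence of the bodies is needed at
  -- every assignment and not just at `α`.
  ∃-cong : (x : Fin k) (φ ψ : Formula σ k) → truth φ ≐ᵗ truth ψ →
           truth (∃′ x ∙ φ) ≐ᵗ truth (∃′ x ∙ ψ)
  ∃-cong x φ ψ eq 𝒳 α = does-⇔
    (mk⇔ (map₂ (truth⇒Sat φ ψ eq 𝒳 _)) (map₂ (truth⇒Sat ψ φ (λ 𝒴 β → sym (eq 𝒴 β)) 𝒳 _)))
    (Sat? 𝒳 α (∃′ x ∙ φ)) (Sat? 𝒳 α (∃′ x ∙ ψ))

  ∀-cong : (x : Fin k) (φ ψ : Formula σ k) → truth φ ≐ᵗ truth ψ →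
           truth (∀′ x ∙ φ) ≐ᵗ truth (∀′ x ∙ ψ)
  ∀-cong x φ ψ eq 𝒳 α = does-⇔
    (mk⇔ (λ s u → truth⇒Sat φ ψ eq 𝒳 _ (s u))
         (λ s u → truth⇒Sat ψ φ (λ 𝒴 β → sym (eq 𝒴 β)) 𝒳 _ (s u)))
    (Sat? 𝒳 α (∀′ x ∙ φ)) (Sat? 𝒳 α (∀′ x ∙ ψ))

  ∈-head : {A : Set} → .{{NonZero n}} → (xs : Vec A n) → ∃[ x ] x ∈ᵥ xs
  ∈-head (x ∷ _) = x , Vec.here refl

  -- Every atom contains a variable because arities are positive; following left subformulas
  -- therefore ends at a free variable or meets a quantifier. For a sentence this gives r ≥ 1,
  -- together with a variable for writing constants.
  free⊎quantifier : (φ : Formula σ k) → ∃ (Free φ) ⊎ (Fin k × NonZero (#quantifiers φ))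
  free⊎quantifier (rel R xs) = inj₁ (∈-head {{positive σ R}} xs)
  free⊎quantifier (x ≈′ y)   = inj₁ (x , inj₁ refl)
  free⊎quantifier (¬′ φ)     = free⊎quantifier φ
  free⊎quantifier (φ ∧′ ψ)   = Sum.map (map₂ inj₁)
    (map₂ λ nz → >-nonZero (m≤n⇒m≤n+o _ (>-nonZero⁻¹ _ {{nz}}))) (free⊎quantifier φ)
  free⊎quantifier (φ ∨′ ψ)   = Sum.map (map₂ inj₁)
    (map₂ λ nz → >-nonZero (m≤n⇒m≤n+o _ (>-nonZero⁻¹ _ {{nz}}))) (free⊎quantifier φ)
  free⊎quantifier (∃′ x ∙ φ) = inj₂ (x , _)
  free⊎quantifier (∀′ x ∙ φ) = inj₂ (x , _)

-- Atoms and their Boolean combinations.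

module Atoms (σ : Signature) (k : ℕ) where

  Atom : Set
  Atom = (∃[ R ] Vec (Fin k) (arity σ R)) ⊎ (Fin k × Fin k)

  infix 4 _≟ᵃ_
  _≟ᵃ_ : DecidableEquality Atom
  _≟ᵃ_ = Sum.≡-dec (Product.≡-dec Fin._≟_ (Vec.≡-dec Fin._≟_)) (Product.≡-dec Fin._≟_ Fin._≟_)

  ⌈_⌉ : Atom → Formula σ k
  ⌈ inj₁ (R , xs) ⌉ = rel R xs
  ⌈ inj₂ (x , y) ⌉  = x ≈′ y

  -- A syntax of its own, since formulas lack constants. The size of an expression is never
  -- measured: it becomes a formula only through Shannon expansion, whose size depends on the atoms
  -- alone.
  data BoolExpr : Set where
    constant : Bool → BoolExpr
    atom     : Atom → BoolExpr
    not′     : BoolExpr → BoolExpr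
    _and′_   : BoolExpr → BoolExpr → BoolExpr

  eval : (Atom → Bool) → BoolExpr → Bool
  eval v (constant b) = b
  eval v (atom a)     = v a
  eval v (not′ θ)     = not (eval v θ)
  eval v (θ and′ η)   = eval v θ ∧ eval v η

  atoms : BoolExpr → List Atom
  atoms (constant _) = []
  atoms (atom a)     = [ a ]
  atoms (not′ θ)     = atoms θ
  atoms (θ and′ η)   = atoms θ ++ atoms η

  Over : Pred (Fin k) 0ℓ → Pred BoolExpr 0ℓ
  Over V θ = All (λ a → Free ⌈ a ⌉ ⊆ V) (atoms θ)

  eval-local : ∀ {v w} θ → (∀ {a} → a ∈ˡ atoms θ → v a ≡ w a) → eval v θ ≡ eval w θ
  eval-local (constant b) eq = refl
  eval-local (atom a)     eq = eq (Any.here refl)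
  eval-local (not′ θ)     eq = cong not (eval-local θ eq)
  eval-local (θ and′ η)   eq =
    cong₂ _∧_ (eval-local θ (eq ∘ ∈-++⁺ˡ)) (eval-local η (eq ∘ ∈-++⁺ʳ (atoms θ)))

  valuation : ∀ 𝒳 → Assignment 𝒳 k → Atom → Bool
  valuation 𝒳 α a = truth ⌈ a ⌉ 𝒳 α

  meaning : BoolExpr → Meaning {σ} k
  meaning θ 𝒳 α = eval (valuation 𝒳 α) θ

  _[_≔_] : (Atom → Bool) → Atom → Bool → Atom → Bool
  (v [ a ≔ b ]) c = if does (c ≟ᵃ a) then b else v c

  -- This preserves the invariant of the expansion: each relevant atom is either still to be split
  -- on or already has its true value.
  update-agrees : ∀ v a (t : Atom → Bool) {as c} → c ∈ˡ a ∷ as ⊎ v c ≡ t c →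
                  c ∈ˡ as ⊎ (v [ a ≔ t a ]) c ≡ t c
  update-agrees v a t {c = c} h with c ≟ᵃ a | h
  ... | yes refl | _                     = inj₂ refl
  ... | no c≢a   | inj₁ (Any.here c≡a)   = contradiction c≡a c≢a
  ... | no _     | inj₁ (Any.there c∈as) = inj₁ c∈as
  ... | no _     | inj₂ eq               = inj₂ eq

  vectors : ∀ n → List (Vec (Fin k) n)
  vectors 0       = [ [] ]
  vectors (suc n) = cartesianProductWith _∷_ (allFin k) (vectors n)

  ∈-vectors : (xs : Vec (Fin k) n) → xs ∈ˡ vectors n
  ∈-vectors []       = Any.here refl
  ∈-vectors (x ∷ xs) = ∈-cartesianProductWith⁺ _∷_ (∈-allFin x) (∈-vectors xs)

  allAtoms : List Atom
  allAtoms = concatMap (λ R → List.map (inj₁ ∘ (R ,_)) (vectors (arity σ R))) (allFin _)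
          ++ cartesianProductWith (λ x y → inj₂ (x , y)) (allFin k) (allFin k)

  ∈-allAtoms : ∀ a → a ∈ˡ allAtoms
  ∈-allAtoms (inj₁ (R , xs)) = ∈-++⁺ˡ (∈-concatMap⁺ _
    (Any.map (λ { refl → ∈-map⁺ _ (∈-vectors xs) }) (∈-allFin R)))
  ∈-allAtoms (inj₂ (x , y))  = ∈-++⁺ʳ _ (∈-cartesianProductWith⁺ _ (∈-allFin x) (∈-allFin y))

  -- Shannon expansion.

  -- x₀ serves to write down the constants, which are not part of the syntax.
  module Expansion (x₀ : Fin k) where
    open import Data.List.Membership.DecPropositional _≟ᵃ_ using (_∈?_)

    -- Unlike ∃x (x = x), this is valid also in the empty structure.
    bool : Bool → Formula σ k
    bool true  = ∀′ x₀ ∙ x₀ ≈′ x₀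
    bool false = ¬′ bool true

    truth-bool : ∀ b → truth (bool b) ≐ᵗ (λ _ _ → b)
    truth-bool true  𝒳 α = valid α
      where
      valid : ∀ α → truth (bool true) 𝒳 α ≡ true
      valid α = dec-true (Sat? 𝒳 α (bool true))
        λ u → u , updateAt-updates x₀ α , updateAt-updates x₀ α
    truth-bool false 𝒳 α = cong not (truth-bool true 𝒳 α)

    bool-closed : ∀ b → Sentence (bool b)
    bool-closed true  x (x≢x₀ , x∈) = [ x≢x₀ , x≢x₀ ]′ x∈
    bool-closed false x x∈          = bool-closed true x x∈

    shannon : List Atom → (Atom → Bool) → BoolExpr → Formula σ k
    shannon []       v θ = bool (eval v θ)
    shannon (a ∷ as) v θ = (⌈ a ⌉ ∧′ shannon as (v [ a ≔ true ]) θ)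
                        ∨′ (¬′ ⌈ a ⌉ ∧′ shannon as (v [ a ≔ false ]) θ)

    shannon-free : ∀ as {v θ} {V : Pred (Fin k) 0ℓ} → All (λ a → Free ⌈ a ⌉ ⊆ V) as →
                   Free (shannon as v θ) ⊆ V
    shannon-free []       {v} {θ} []  x∈                = ⊥-elim (bool-closed (eval v θ) _ x∈)
    shannon-free (a ∷ as) (a⊆ ∷ _)  (inj₁ (inj₁ x∈)) = a⊆ x∈
    shannon-free (a ∷ as) (_ ∷ as⊆) (inj₁ (inj₂ x∈)) = shannon-free as as⊆ x∈
    shannon-free (a ∷ as) (a⊆ ∷ _)  (inj₂ (inj₁ x∈)) = a⊆ x∈
    shannon-free (a ∷ as) (_ ∷ as⊆) (inj₂ (inj₂ x∈)) = shannon-free as as⊆ x∈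

    -- The truth value of the head atom selects one disjunct, in which the recorded value of that
    -- atom is the true one. At a leaf all atoms of `θ` are settled, and `eval-local` applies.
    truth-shannon : ∀ as {v} θ 𝒳 α →
                    (∀ {c} → c ∈ˡ atoms θ → c ∈ˡ as ⊎ v c ≡ valuation 𝒳 α c) →
                    truth (shannon as v θ) 𝒳 α ≡ meaning θ 𝒳 α
    truth-shannon []       θ 𝒳 α h = trans (truth-bool _ 𝒳 α)
      (eval-local θ λ c∈ → [ (λ ()) , id ]′ (h c∈))
    truth-shannon (a ∷ as) {v} θ 𝒳 α h
      -- Abstracting the value in the type of `update-agrees` as well makes its updated valuation
      -- the one of the selected branch.
      with valuation 𝒳 α a | update-agrees v a (valuation 𝒳 α) {as}
    ... | true  | step = trans (∨-identityʳ _) (truth-shannon as θ 𝒳 α (step ∘ h))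
    ... | false | step = truth-shannon as θ 𝒳 α (step ∘ h)

    -- Splitting on atoms outside `θ` would introduce new free variables, whereas `atoms θ` may
    -- contain many repetitions. Filtering `allAtoms` avoids the former and bounds the length.
    occurring : BoolExpr → List Atom
    occurring θ = filter (_∈? atoms θ) allAtoms

    realise : BoolExpr → Formula σ k
    -- The initial value `false` of each atom of `θ` is overwritten before a leaf is reached.
    realise θ = shannon (occurring θ) (λ _ → false) θ

    realise-free : ∀ {V} θ → Over V θ → Free (realise θ) ⊆ V
    realise-free θ θ⊆ = shannon-free (occurring θ)
      (All.tabulate λ a∈ → All.lookup θ⊆ (proj₂ (∈-filter⁻ (_∈? atoms θ) {xs = allAtoms} a∈)))

    truth-realise : ∀ θ → truth (realise θ) ≐ᵗ meaning θ
    truth-realise θ 𝒳 α = truth-shannon (occurring θ) θ 𝒳 α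
      λ {c} c∈ → inj₁ (∈-filter⁺ (_∈? atoms θ) (∈-allAtoms c) c∈)

    -- Size of the expansion.

    module Sizes (A : ℕ) (arity≤A : ∀ R → arity σ R ≤ A) where
      open ≤-Reasoning

      atom-size : ∀ a → size ⌈ a ⌉ ≤ 3 + 2 * A
      atom-size (inj₁ (R , xs)) = begin
        3 + m + (m ∸ 1) ≤⟨ +-mono-≤ (+-monoʳ-≤ 3 (arity≤A R)) (≤-trans (m∸n≤m m 1) (arity≤A R)) ⟩
        3 + A + A       ≡⟨ lemma A ⟩
        3 + 2 * A       ∎
        where
        m = arity σ R
        lemma : ∀ A → 3 + A + A ≡ 3 + 2 * A
        lemma = solve-∀
      atom-size (inj₂ _)        = m≤m+n 3 _

      bool-size : ∀ b → size (bool b) ≤ 6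
      bool-size true  = n≤1+n 5
      bool-size false = ≤-refl

      -- The summand 16 + 4A pays for one more expansion step.
      shannon-size : ∀ as v θ → size (shannon as v θ) + (16 + 4 * A) ≤ 2 ^ length as * (22 + 4 * A)
      shannon-size []       v θ = begin
        size (bool (eval v θ)) + (16 + 4 * A) ≤⟨ +-monoˡ-≤ _ (bool-size (eval v θ)) ⟩
        22 + 4 * A                           ≡⟨ *-identityˡ (22 + 4 * A) ⟨
        1 * (22 + 4 * A)                     ∎
      shannon-size (a ∷ as) v θ = begin
        3 + (3 + p + s) + (3 + (1 + p) + t) + E ≡⟨ lemma₁ p s t E ⟩
        s + t + (2 * p + (10 + E))
          ≤⟨ +-monoʳ-≤ (s + t) (+-monoˡ-≤ _ (*-monoʳ-≤ 2 (atom-size a))) ⟩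
        s + t + (2 * (3 + 2 * A) + (10 + E))    ≡⟨ lemma₂ s t A ⟩
        (s + E) + (t + E)                       ≤⟨ +-mono-≤ (shannon-size as _ θ) (shannon-size as _ θ) ⟩
        2 ^ l * F + 2 ^ l * F                   ≡⟨ lemma₃ (2 ^ l) F ⟩
        2 * 2 ^ l * F                           ∎
        where
        p = size ⌈ a ⌉
        s = size (shannon as (v [ a ≔ true ]) θ)
        t = size (shannon as (v [ a ≔ false ]) θ)
        l = length as
        E = 16 + 4 * A
        F = 22 + 4 * A
        lemma₁ : ∀ p s t E → 3 + (3 + p + s) + (3 + (1 + p) + t) + E ≡ s + t + (2 * p + (10 + E))
        lemma₁ = solve-∀
        lemma₂ : ∀ s t A → s + t + (2 * (3 + 2 * A) + (10 + (16 + 4 * A)))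
                           ≡ (s + (16 + 4 * A)) + (t + (16 + 4 * A))
        lemma₂ = solve-∀
        lemma₃ : ∀ x F → x * F + x * F ≡ 2 * x * F
        lemma₃ = solve-∀

      D : ℕ
      D = 2 ^ length allAtoms * (22 + 4 * A)

      realise-size : ∀ θ → size (realise θ) ≤ D
      realise-size θ = begin
        size (realise θ)                         ≤⟨ m≤m+n _ _ ⟩
        size (realise θ) + (16 + 4 * A)          ≤⟨ shannon-size (occurring θ) _ θ ⟩
        2 ^ length (occurring θ) * (22 + 4 * A)
          ≤⟨ *-monoˡ-≤ _ (^-monoʳ-≤ 2 (length-filter (_∈? atoms θ) allAtoms)) ⟩
        D                                        ∎

    -- Compressed forms and their realisation.

    module Compression {D : ℕ} (realise-size : ∀ θ → size (realise θ) ≤ D) where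
      open ≤-Reasoning

      -- `B` is the cost of writing a pivot around its core: two realised expressions, two binary
      -- connectives of 3 symbols each, and a possible negation. `C` is the cost of joining two
      -- pivots: `B` for each and 3 for the connective.
      B C : ℕ
      B = 2 * D + 7
      C = 2 * B + 3

      D≤B : D ≤ B
      D≤B = ≤-trans (m≤m+n D _) (m≤m+n (2 * D) 7)

      -- Only the core is charged for, as `meet` and `join` can grow without exceeding `D` once
      -- realised. The budget of the core is (2r - 1) times `C`.
      record Pivot (V : Pred (Fin k) 0ℓ) (t : Meaning {σ} k) (r : ℕ) : Set₁ where
        field
          sign          : Bool
          core          : Formula σ k
          meet join     : BoolExpr
          core⊆         : Free core ⊆ V
          meet⊆         : Over V meet
          join⊆         : Over V join
          decomposition : t ≐ᵗ λ 𝒳 α →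
            ((sign xor truth core 𝒳 α) ∧ meaning meet 𝒳 α) ∨ meaning join 𝒳 α
          -- The slack C pays for realising two pivots when they are conjoined.
          core-size     : size core + C ≤ 2 * C * r

      -- The Boolean case needs no size bound and is available for r = 0, where no pivot exists
      -- because `C` is positive.
      data Compressed (V : Pred (Fin k) 0ℓ) (t : Meaning {σ} k) (r : ℕ) : Set₁ where
        boolean : (θ : BoolExpr) → Over V θ → t ≐ᵗ meaning θ → Compressed V t r
        pivoted : Pivot V t r → Compressed V t r

      record Realisation (V : Pred (Fin k) 0ℓ) (t : Meaning {σ} k) (m : ℕ) : Set₁ where
        field
          formula    : Formula σ k
          formula⊆   : Free formula ⊆ V
          realises   : truth formula ≐ᵗ t
          size-bound : size formula ≤ m

      signed : Bool → Formula σ k → Formula σ k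
      signed false χ = χ
      signed true  χ = ¬′ χ

      truth-signed : ∀ s χ → truth (signed s χ) ≐ᵗ λ 𝒳 α → s xor truth χ 𝒳 α
      truth-signed false χ 𝒳 α = refl
      truth-signed true  χ 𝒳 α = refl

      signed-free : ∀ s χ → Free (signed s χ) ⊆ Free χ
      signed-free false χ x∈ = x∈
      signed-free true  χ x∈ = x∈

      signed-size : ∀ s χ → size (signed s χ) ≤ suc (size χ)
      signed-size false χ = n≤1+n _
      signed-size true  χ = ≤-refl

      realisePivot : ∀ {V t} → (p : Pivot V t r) → Realisation V t (size (Pivot.core p) + B)
      realisePivot {t = t} p = record
        { formula    = (signed sign core ∧′ realise meet) ∨′ realise join
        ; formula⊆   = [ [ core⊆ ∘ signed-free sign core , realise-free meet meet⊆ ]′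
                       , realise-free join join⊆ ]′
        ; realises   = λ 𝒳 α → trans
            (cong₂ _∨_ (cong₂ _∧_ (truth-signed sign core 𝒳 α) (truth-realise meet 𝒳 α))
                       (truth-realise join 𝒳 α))
            (sym (decomposition 𝒳 α))
        ; size-bound = begin
            3 + (3 + size (signed sign core) + size (realise meet)) + size (realise join)
              ≤⟨ +-mono-≤ (+-monoʳ-≤ 3 (+-mono-≤ (+-monoʳ-≤ 3 (signed-size sign core))
                                              (realise-size meet)))
                          (realise-size join) ⟩
            3 + (3 + suc (size core) + D) + D
              ≡⟨ lemma (size core) D ⟩
            size core + B ∎
        }
        where
        open Pivot p
        lemma : ∀ s D → 3 + (3 + suc s + D) + D ≡ s + (2 * D + 7)
        lemma = solve-∀

      realiseCompressed : ∀ {V t} → Compressed V t r → Realisation V t (2 * C * r + B)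
      realiseCompressed {r} (boolean θ θ⊆ eq) = record
        { formula    = realise θ
        ; formula⊆   = realise-free θ θ⊆
        ; realises   = λ 𝒳 α → trans (truth-realise θ 𝒳 α) (sym (eq 𝒳 α))
        ; size-bound = ≤-trans (realise-size θ) (≤-trans D≤B (m≤n+m B (2 * C * r)))
        }
      realiseCompressed (pivoted p) = record
        { Realisation (realisePivot p)
        ; size-bound = ≤-trans (Realisation.size-bound (realisePivot p))
            (+-monoˡ-≤ B (≤-trans (m≤m+n (size (Pivot.core p)) C) (Pivot.core-size p)))
        }

      over-⊆ : ∀ {V W} θ → V ⊆ W → Over V θ → Over W θ
      over-⊆ θ V⊆W = All.map λ a⊆ {x} x∈ → V⊆W (a⊆ x∈)

      weaken : ∀ {V W t} → V ⊆ W → Compressed V t r → Compressed W t r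
      weaken V⊆W (boolean θ θ⊆ eq) = boolean θ (over-⊆ θ V⊆W θ⊆) eq
      weaken V⊆W (pivoted p)       = pivoted record
        { Pivot p
        ; core⊆ = V⊆W ∘ core⊆
        ; meet⊆ = over-⊆ meet V⊆W meet⊆
        ; join⊆ = over-⊆ join V⊆W join⊆
        }
        where open Pivot p

      respects : ∀ {V t t′} → t′ ≐ᵗ t → Compressed V t r → Compressed V t′ r
      respects eq (boolean θ θ⊆ eq′) = boolean θ θ⊆ λ 𝒳 α → trans (eq 𝒳 α) (eq′ 𝒳 α)
      respects eq (pivoted p)        = pivoted record
        { Pivot p ; decomposition = λ 𝒳 α → trans (eq 𝒳 α) (Pivot.decomposition p 𝒳 α) }

      -- The only source of new cores; all other operations on pivots keep the core and its size.
      pivotAt : ∀ {V} (χ : Formula σ k) → Free χ ⊆ V → size χ + C ≤ 2 * C * r →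
                Compressed V (truth χ) r
      pivotAt χ χ⊆ bound = pivoted record
        { sign          = false
        ; core          = χ
        ; meet          = constant true
        ; join          = constant false
        ; core⊆         = χ⊆
        ; meet⊆         = []
        ; join⊆         = []
        ; decomposition = λ 𝒳 α → sym (trans (∨-identityʳ _) (∧-identityʳ _))
        ; core-size     = bound
        }

      -- Closure under Boolean connectives.

      -- By De Morgan, ¬((x ∧ m) ∨ j) is (¬x ∨ ¬m) ∧ ¬j, and distributing gives (¬x ∧ ¬j) ∨ (¬m ∧
      -- ¬j). Thus the core only changes its sign, at no cost.
      negate : ∀ {V t} → Compressed V t r → Compressed V (λ 𝒳 α → not (t 𝒳 α)) r
      negate (boolean θ θ⊆ eq) = boolean (not′ θ) θ⊆ λ 𝒳 α → cong not (eq 𝒳 α)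
      negate (pivoted p)       = pivoted record
        { Pivot p
        ; sign          = not sign
        ; meet          = not′ join
        ; join          = not′ meet and′ not′ join
        ; meet⊆         = join⊆
        ; join⊆         = All.++⁺ meet⊆ join⊆
        ; decomposition = λ 𝒳 α → trans (cong not (decomposition 𝒳 α)) (lemma sign _ _ _)
        }
        where
        open Pivot p
        lemma : ∀ s x m j → not (((s xor x) ∧ m) ∨ j) ≡
                            ((not s xor x) ∧ not j) ∨ (not m ∧ not j)
        lemma s x m j
          rewrite BooleanAlgebra.deMorgan₂ ((s xor x) ∧ m) j
                | BooleanAlgebra.deMorgan₁ (s xor x) m
                | sym (not-distribˡ-xor s x)
          = ∧-distribʳ-∨ (not j) (not (s xor x)) (not m)

      increase : ∀ {V t m n} → m ≤ n → Pivot V t m → Pivot V t n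
      increase m≤n p = record
        { Pivot p ; core-size = ≤-trans (Pivot.core-size p) (*-monoʳ-≤ (2 * C) m≤n) }

      -- Conjunction distributes over the disjunction, so `θ` is absorbed by both Boolean parts.
      restrict : ∀ {V t} θ → Over V θ → Pivot V t r →
                 Pivot V (λ 𝒳 α → t 𝒳 α ∧ meaning θ 𝒳 α) r
      restrict θ θ⊆ p = record
        { Pivot p
        ; meet          = meet and′ θ
        ; join          = join and′ θ
        ; meet⊆         = All.++⁺ meet⊆ θ⊆
        ; join⊆         = All.++⁺ join⊆ θ⊆
        ; decomposition = λ 𝒳 α → trans (cong (_∧ _) (decomposition 𝒳 α))
            (trans (∧-distribʳ-∨ (meaning θ 𝒳 α) ((sign xor truth core 𝒳 α) ∧ meaning meet 𝒳 α) _)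
                   (cong (_∨ (meaning join 𝒳 α ∧ meaning θ 𝒳 α))
                         (∧-assoc (sign xor _) (meaning meet 𝒳 α) _)))
        }
        where open Pivot p

      -- A new core is formed only if both sides have one. Their bounds leave a slack of `C` each:
      -- one pays for realising and joining the two pivots, the other remains as the slack of the
      -- result.
      conjoin : ∀ {m n V t u} → Compressed V t m → Compressed V u n →
                Compressed V (λ 𝒳 α → t 𝒳 α ∧ u 𝒳 α) (m + n)
      conjoin {m} {n} (boolean θ θ⊆ eq) (boolean η η⊆ eq′) =
        boolean (θ and′ η) (All.++⁺ θ⊆ η⊆) λ 𝒳 α → cong₂ _∧_ (eq 𝒳 α) (eq′ 𝒳 α)
      conjoin {m} {n} {t = t} {u} (boolean θ θ⊆ eq) (pivoted p) =
        respects (λ 𝒳 α → trans (∧-comm (t 𝒳 α) (u 𝒳 α)) (cong (_ ∧_) (eq 𝒳 α)))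
          (pivoted (restrict θ θ⊆ (increase (m≤n+m n m) p)))
      conjoin {m} {n} (pivoted p) (boolean θ θ⊆ eq) =
        respects (λ 𝒳 α → cong (_ ∧_) (eq 𝒳 α)) (pivoted (restrict θ θ⊆ (increase (m≤m+n m n) p)))
      conjoin {m} {n} (pivoted p) (pivoted q) =
        respects (λ 𝒳 α → sym (cong₂ _∧_ (P.realises 𝒳 α) (Q.realises 𝒳 α)))
          (pivotAt (P.formula ∧′ Q.formula) [ P.formula⊆ , Q.formula⊆ ]′ (begin
            3 + size P.formula + size Q.formula + C
              ≤⟨ +-monoˡ-≤ C (+-mono-≤ (+-monoʳ-≤ 3 P.size-bound) Q.size-bound) ⟩
            3 + (s + B) + (t + B) + C
              ≡⟨ lemma s t B ⟩
            (s + C) + (t + C)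
              ≤⟨ +-mono-≤ (Pivot.core-size p) (Pivot.core-size q) ⟩
            2 * C * m + 2 * C * n
              ≡⟨ *-distribˡ-+ (2 * C) m n ⟨
            2 * C * (m + n) ∎))
        where
        module P = Realisation (realisePivot p)
        module Q = Realisation (realisePivot q)
        s = size (Pivot.core p)
        t = size (Pivot.core q)
        lemma : ∀ s t B → 3 + (s + B) + (t + B) + (2 * B + 3)
                          ≡ (s + (2 * B + 3)) + (t + (2 * B + 3))
        lemma = solve-∀

      -- Quantifiers and the compression of formulas.

      -- A quantifier raises the budget by twice `C`: one `C` covers its two symbols and the `B` of
      -- the realised body, the other restores the slack.
      quantifier-bound : ∀ {m} r → m ≤ 2 * C * r + B → 2 + m + C ≤ 2 * C * suc r
      quantifier-bound {m} r m≤ = begin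
        2 + m + C                   ≤⟨ +-monoˡ-≤ C (+-monoʳ-≤ 2 m≤) ⟩
        -- Padding by 1 + `B` completes 2 + `B` to `C`.
        2 + (2 * C * r + B) + C     ≤⟨ m≤m+n _ (1 + B) ⟩
        2 + (2 * C * r + B) + C + (1 + B) ≡⟨ lemma r B ⟩
        2 * C * suc r               ∎
        where
        lemma : ∀ r B → 2 + (2 * (2 * B + 3) * r + B) + (2 * B + 3) + (1 + B)
                        ≡ 2 * (2 * B + 3) * (1 + r)
        lemma = solve-∀

      -- A quantifier cannot be moved past the compressed form of its body, so the body is realised
      -- there and the quantified formula becomes the new core.
      compress : ∀ φ → Compressed (Free φ) (truth φ) (#quantifiers φ)
      compress (rel R xs) = boolean (atom (inj₁ (R , xs))) (id ∷ []) λ _ _ → refl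
      compress (x ≈′ y)   = boolean (atom (inj₂ (x , y))) (id ∷ []) λ _ _ → refl
      compress (¬′ φ)     = negate (compress φ)
      compress (φ ∧′ ψ)   = conjoin (weaken inj₁ (compress φ)) (weaken inj₂ (compress ψ))
      -- Since negation is free, a disjunction costs no more than a conjunction.
      compress (φ ∨′ ψ)   = respects (λ 𝒳 α → de-morgan (truth φ 𝒳 α) _) (negate
        (conjoin (negate (weaken inj₁ (compress φ))) (negate (weaken inj₂ (compress ψ)))))
        where
        de-morgan : ∀ a b → a ∨ b ≡ not (not a ∧ not b)
        de-morgan true  b = refl
        de-morgan false b = sym (not-involutive b)
      compress (∃′ x ∙ φ) =
        respects (λ 𝒳 α → sym (∃-cong x formula φ realises 𝒳 α))
          (pivotAt (∃′ x ∙ formula) (map₂ formula⊆) (quantifier-bound (#quantifiers φ) size-bound))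
        where open Realisation (realiseCompressed (compress φ))
      compress (∀′ x ∙ φ) =
        respects (λ 𝒳 α → sym (∀-cong x formula φ realises 𝒳 α))
          (pivotAt (∀′ x ∙ formula) (map₂ formula⊆) (quantifier-bound (#quantifiers φ) size-bound))
        where open Realisation (realiseCompressed (compress φ))

      -- The compressed formula has no free variables beyond those of `ψ`, so it is again a
      -- sentence; being equivalent to `ψ` in every pebbled structure, it inherits the disagreement.
      shorten : ∀ {a b} {𝔄 : Pred (PebbledStructure σ k) a} {𝔅 : Pred (PebbledStructure σ k) b} →
                ∀ ψ → Sentence ψ → DisagreeOn ψ 𝔄 𝔅 →
                ∃[ φ ] (DisagreeOn φ 𝔄 𝔅 × size φ ≤ 2 * C * #quantifiers ψ + B)
      shorten ψ closed (_ , 𝔄⊨ψ , 𝔅⊭ψ) = formula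
        , ( (λ _ _ {x} x∈ → contradiction (formula⊆ x∈) (closed x))
          , (λ X X∈ → truth⇒Sat ψ formula (λ 𝒳 α → sym (realises 𝒳 α)) _ _ (𝔄⊨ψ X X∈))
          , (λ X X∈ → 𝔅⊭ψ X X∈ ∘ truth⇒Sat formula ψ realises _ _))
        , size-bound
        where open Realisation (realiseCompressed (compress ψ))

-- Counting atoms and the final arithmetic.

module Counting (σ : Signature) where
  open ≤-Reasoning

  -- Starting the maximum at 2 covers the equality atoms and makes `A` positive.
  A : ℕ
  A = max 2 (List.tabulate (arity σ))

  arity≤A : ∀ R → arity σ R ≤ A
  arity≤A = All.tabulate⁻ (xs≤max 2 (List.tabulate (arity σ)))

  2≤A : 2 ≤ A
  2≤A = ⊥≤max 2 (List.tabulate (arity σ))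

  length-cartesianProductWith : ∀ {X Y Z : Set} (f : X → Y → Z) xs ys →
    length (cartesianProductWith f xs ys) ≡ length xs * length ys
  length-cartesianProductWith f []       ys = refl
  length-cartesianProductWith f (x ∷ xs) ys = trans (length-++ (List.map (f x) ys))
    (cong₂ _+_ (length-map (f x) ys) (length-cartesianProductWith f xs ys))

  length-concatMap≤ : ∀ {X Y : Set} (f : X → List Y) {m} → (∀ x → length (f x) ≤ m) →
                      ∀ xs → length (concatMap f xs) ≤ length xs * m
  length-concatMap≤ f     f≤ []       = z≤n
  length-concatMap≤ f {m} f≤ (x ∷ xs) = begin
    length (f x ++ concatMap f xs)        ≡⟨ length-++ (f x) ⟩
    length (f x) + length (concatMap f xs) ≤⟨ +-mono-≤ (f≤ x) (length-concatMap≤ f f≤ xs) ⟩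
    m + length xs * m                     ∎

  module _ (k : ℕ) .{{k≢0 : NonZero k}} where
    open Atoms σ k

    instance
      k^k≢0 : NonZero (k ^ k)
      k^k≢0 = m^n≢0 k k

    -- If k ≤ `A`, the power is at most `A ^ A`; otherwise it is at most `k ^ k`. The product covers
    -- both, and its first factor depends only on the signature.
    k^m≤A^A*k^k : ∀ {m} → m ≤ A → k ^ m ≤ A ^ A * k ^ k
    k^m≤A^A*k^k {m} m≤A = ≤-trans (^-monoʳ-≤ k m≤A) (case ≤-total k A of λ where
      (inj₁ k≤A) → ≤-trans (^-monoˡ-≤ A k≤A) (m≤m*n (A ^ A) (k ^ k))
      (inj₂ A≤k) → ≤-trans (^-monoʳ-≤ k A≤k)
        (m≤n*m (k ^ k) (A ^ A) {{m^n≢0 A A {{>-nonZero (≤-trans (s≤s z≤n) 2≤A)}}}}))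

    length-vectors : ∀ n → length (vectors n) ≡ k ^ n
    length-vectors 0       = refl
    length-vectors (suc n) = trans (length-cartesianProductWith _∷_ (allFin k) (vectors n))
      (cong₂ _*_ (length-tabulate {n = k} id) (length-vectors n))

    length-allAtoms : length allAtoms ≤ suc (#symbols σ) * A ^ A * k ^ k
    length-allAtoms = begin
      length allAtoms             ≡⟨ length-++ (concatMap relations (allFin _)) ⟩
      length (concatMap relations (allFin _)) + length equalities
        ≤⟨ +-mono-≤ (length-concatMap≤ relations relations-length (allFin _)) equalities-length ⟩
      length (allFin (#symbols σ)) * W + W
        ≡⟨ cong (λ l → l * W + W) (length-tabulate {n = #symbols σ} id) ⟩
      #symbols σ * W + W          ≡⟨ +-comm _ W ⟩
      suc (#symbols σ) * W        ≡⟨ *-assoc (suc (#symbols σ)) (A ^ A) (k ^ k) ⟨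
      suc (#symbols σ) * A ^ A * k ^ k ∎
      where
      W = A ^ A * k ^ k
      relations : Fin (#symbols σ) → List Atom
      relations R = List.map (inj₁ ∘ (R ,_)) (vectors (arity σ R))
      relations-length : ∀ R → length (relations R) ≤ W
      relations-length R = begin
        length (relations R)         ≡⟨ length-map _ (vectors (arity σ R)) ⟩
        length (vectors (arity σ R)) ≡⟨ length-vectors (arity σ R) ⟩
        k ^ arity σ R                ≤⟨ k^m≤A^A*k^k (arity≤A R) ⟩
        W                            ∎
      equalities : List Atom
      equalities = cartesianProductWith (λ x y → inj₂ (x , y)) (allFin k) (allFin k)
      equalities-length : length equalities ≤ W
      equalities-length = begin
        length equalities ≡⟨ length-cartesianProductWith _ (allFin k) (allFin k) ⟩
        length (allFin k) * length (allFin k) ≡⟨ cong (λ l → l * l) (length-tabulate {n = k} id) ⟩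
        k * k             ≡⟨ cong (k *_) (*-identityʳ k) ⟨
        k ^ 2             ≤⟨ k^m≤A^A*k^k 2≤A ⟩
        W                 ∎

  n≤2^n : ∀ n → n ≤ 2 ^ n
  n≤2^n 0       = z≤n
  n≤2^n (suc n) = +-mono-≤ (m^n>0 2 n) (≤-trans (n≤2^n n) (m≤m+n _ 0))

  2^l*q≤2^[l+q] : ∀ l q → 2 ^ l * q ≤ 2 ^ (l + q)
  2^l*q≤2^[l+q] l q = ≤-trans (*-monoʳ-≤ (2 ^ l) (n≤2^n q))
    (≤-reflexive (sym (^-distribˡ-+-* 2 l q)))

  -- With `B` and `C` expanded, 2C + B equals 41 + 10D; the factor of the power of 2 in `D` is 22 +
  -- 4A.
  overhead : ℕ
  overhead = 41 + 10 * (22 + 4 * A)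

  exponent : ℕ
  exponent = suc (#symbols σ) * A ^ A + overhead

  -- The factor `q` moves into the exponent by q ≤ 2^q, and there q ≤ q * w because `w` is positive.
  2^l*q≤2^[c*w] : ∀ {l c q w} .{{w≢0 : NonZero w}} → l ≤ c * w → 2 ^ l * q ≤ 2 ^ ((c + q) * w)
  2^l*q≤2^[c*w] {l} {c} {q} {w} l≤ = begin
    2 ^ l * q         ≤⟨ 2^l*q≤2^[l+q] l q ⟩
    2 ^ (l + q)       ≤⟨ ^-monoʳ-≤ 2 (+-mono-≤ l≤ (m≤m*n q w)) ⟩
    2 ^ (c * w + q * w) ≡⟨ cong (2 ^_) (*-distribʳ-+ w c q) ⟨
    2 ^ ((c + q) * w) ∎

  -- As r ≥ 1, the additive `B` is at most `B * r`; as x ≥ 1, the constant 41 is at most `x * 41`.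
  linear-bound : ∀ x F r .{{x≢0 : NonZero x}} .{{r≢0 : NonZero r}} →
                 let B = 2 * (x * F) + 7 ; C = 2 * B + 3 in
                 2 * C * r + B ≤ x * (41 + 10 * F) * r
  linear-bound x F r = begin
    2 * C * r + B       ≤⟨ +-monoʳ-≤ (2 * C * r) (m≤m*n B r) ⟩
    2 * C * r + B * r   ≡⟨ lemma₁ (x * F) r ⟩
    (41 + 10 * (x * F)) * r ≤⟨ *-monoˡ-≤ r (+-monoˡ-≤ (10 * (x * F)) (m≤n*m 41 x)) ⟩
    (x * 41 + 10 * (x * F)) * r ≡⟨ cong (_* r) (lemma₂ x 41 F) ⟩
    x * (41 + 10 * F) * r ∎
    where
    B = 2 * (x * F) + 7
    C = 2 * B + 3
    lemma₁ : ∀ D r → 2 * (2 * (2 * D + 7) + 3) * r + (2 * D + 7) * r ≡ (41 + 10 * D) * r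
    lemma₁ = solve-∀
    lemma₂ : ∀ x n F → x * n + 10 * (x * F) ≡ x * (n + 10 * F)
    lemma₂ = solve-∀

  size-bound : ∀ k r .{{k≢0 : NonZero k}} .{{r≢0 : NonZero r}} →
               let D = 2 ^ length (Atoms.allAtoms σ k) * (22 + 4 * A)
                   B = 2 * D + 7
                   C = 2 * B + 3
               in 2 * C * r + B ≤ 2 ^ (exponent * k ^ k) * r
  size-bound k r = ≤-trans
    (linear-bound (2 ^ l) (22 + 4 * A) r {{m^n≢0 2 l}})
    (*-monoˡ-≤ r (2^l*q≤2^[c*w] {c = suc (#symbols σ) * A ^ A} {{m^n≢0 k k}} (length-allAtoms k)))
    where l = length (Atoms.allAtoms σ k)

lemma11 : ∀ {a b : Level} (σ : Signature) →
    ∃[ c ] (∀ (k r : ℕ)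
    (𝔄 : Pred (PebbledStructure σ k) a)
    (𝔅 : Pred (PebbledStructure σ k) b) →
    Compatible 𝔄 𝔅 →
    (ψ : Formula σ k) → Sentence ψ → #quantifiers ψ ≡ r →
    DisagreeOn ψ 𝔄 𝔅 →
    ∃[ φ ] (DisagreeOn φ 𝔄 𝔅 × size φ ≤ 2 ^ (c * k ^ k) * r))
lemma11 σ = exponent , λ where
    k r 𝔄 𝔅 _ ψ closed refl disagree → case free⊎quantifier ψ of λ where
      -- A sentence excludes the first alternative. In the second, `x₀` also shows that k is
      -- nonzero.
      (inj₁ (x , x∈ψ))  → contradiction x∈ψ (closed x)
      (inj₂ (x₀ , r≢0)) →
        map₂ (map₂ (λ size≤ → ≤-trans size≤ (size-bound k r {{Fin.nonZeroIndex x₀}} {{r≢0}})))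
          (Atoms.Expansion.Compression.shorten σ k x₀
            (Atoms.Expansion.Sizes.realise-size σ k x₀ A arity≤A) ψ closed disagree)
  where
  open Counting σ
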